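{- Let $t$ be an arbitrary positive integer and let $n,k$ be positive integers with $n\ge k^2$. There exists a sufficiently small universal constant $\delta>0$ (independent of $t,k,n$) such that the $\delta$-error randomized one-way communication complexity of the Augmented Sparse Set-Disjointness problem with parameters $t,k,n$ is $\Omega(tk\log k)$.
   Context: Augmented Sparse Set-Disjointness: Alice receives sets $A_1,\dots,A_t\subseteq[n]$ and Bob receives sets $B_1,\dots,B_t\subseteq[n]$, with $|A_j|=|B_j|=k$ for all $j$. Bob additionally receives an index $j\in[t]$ and the sets $A_1,\dots,A_{j-1}$. Alice sends a single message $M$ to Bob (the parties share a public random string), and Bob must output whether $A_j\cap B_j=\emptyset$. A protocol has $\delta$ error if on every input Bob answers correctly with probability at least $1-\delta$; the $\delta$-error complexity is the minimum over such protocols of the maximum message length in bits. -}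

module Defs where

open import Data.Nat using (ℕ; zero; suc; _+_; _*_; _≤_)
open import Data.Bool using (Bool; true; false; not; _∧_; if_then_else_)
open import Data.Fin using (Fin; zero; suc; toℕ)
open import Data.Fin.Subset using (Subset; ∣_∣)
open import Data.Vec using (Vec; []; _∷_)
open import Data.Vec.Relation.Unary.All using (All)
open import Data.List using (List; length)
open import Relation.Binary.PropositionalEquality using (_≡_)

disjointᵇ : ∀ {n} → Subset n → Subset n → Bool
disjointᵇ [] [] = true
disjointᵇ (x ∷ A) (y ∷ B) = not (x ∧ y) ∧ disjointᵇ A B

-- A_1,…,A_{j-1} : the first (toℕ j) entries of a length-t vector (j : Fin t is 0-based).
prefix : ∀ {X : Set} {t} → Vec X t → (j : Fin t) → Vec X (toℕ j)
prefix (a ∷ as) zero = []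
prefix (a ∷ as) (suc j) = a ∷ prefix as j

lookupV : ∀ {X : Set} {t} → Vec X t → Fin t → X
lookupV (a ∷ as) zero = a
lookupV (a ∷ as) (suc j) = lookupV as j

countᵇ : (r : ℕ) → (Vec Bool r → Bool) → ℕ
countᵇ zero P = if P [] then 1 else 0
countᵇ (suc r) P = countᵇ r (λ ρ → P (true ∷ ρ)) + countᵇ r (λ ρ → P (false ∷ ρ))

AllSize : ∀ {n t} → ℕ → Vec (Subset n) t → Set
AllSize k As = All (λ A → ∣ A ∣ ≡ k) As

-- A public-coin one-way protocol for Augmented Sparse Set-Disjointness with
-- parameters t, k, n, using r uniformly random public bits and messages of
-- at most c bits.
record Protocol (t n r c : ℕ) : Set where
  field
    alice     : Vec Bool r → Vec (Subset n) t → List Bool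
    alice-len : ∀ ρ As → length (alice ρ As) ≤ c
    -- Bob's output: true means "A_j ∩ B_j = ∅".
    bob       : Vec Bool r → List Bool → (j : Fin t) → Vec (Subset n) (toℕ j)
                → Vec (Subset n) t → Bool

open Protocol public

correctᵇ : ∀ {t n r c} → Protocol t n r c → Vec (Subset n) t → Vec (Subset n) t
           → Fin t → Vec Bool r → Bool
correctᵇ P As Bs j ρ with bob P ρ (alice P ρ As) j (prefix As j) Bs | disjointᵇ (lookupV As j) (lookupV Bs j)
... | true  | true  = true
... | false | false = true
... | _     | _     = false

HasErrorAtMost1/ : ∀ {t n r c} → (k D : ℕ) → Protocol t n r c → Set
HasErrorAtMost1/ {t} {n} {r} k D P =
  ∀ (As Bs : Vec (Subset n) t) → AllSize k As → AllSize k Bs → (j : Fin t) →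
  countᵇ r (λ ρ → not (correctᵇ P As Bs j ρ)) * D ≤ countᵇ r (λ _ → true)

{-# OPTIONS --safe #-}
module Submission where

-- Restrict to inputs in which each A_j consists of one symbol from each of m = k - 1 blocks of size k
-- and a dummy element, and to queries lying in a single block (up to padding). The membership
-- vectors of distinct symbols differ on half of the queries, so Bob recovers a symbol by nearest-codeword
-- decoding unless a constant fraction of his answers for its block is wrong. For a fixed message,
-- recovering A_j from A_1,…,A_{j-1} is sequential prediction of N = tm symbols, so over all inputs
-- Σ y^hits ≤ (y + k)^N. Low error and Jensen's inequality bound the same sum, taken with Alice's
-- actual messages, from below by y^(N - w) k^N with w ≈ N/12. For y = k³ and N ≥ 24 this leaves at
-- least k^(N/8) messages; for smaller N it suffices that an empty message cannot separate two symbols.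

open import Defs
open import Data.Bool using (Bool; true; false; not; _∧_; _xor_; if_then_else_)
open import Data.Bool.Properties using (∧-identityʳ; ∧-assoc; xor-comm)
open import Data.Fin using (Fin; zero; suc; toℕ)
open import Data.Fin.Properties using (any?) renaming (_≟_ to _≟ᶠ_)
open import Data.Fin.Subset using (Subset; ∣_∣; ⁅_⁆; ⊥)
open import Data.Fin.Subset.Properties using (∣⊥∣≡0; ∣⁅x⁆∣≡1; ∣p∣≤n)
open import Data.List using (List; []; _∷_; _++_; map; length; allFin; cartesianProductWith)
open import Data.List.Membership.Propositional using (_∈_)
open import Data.List.Membership.Propositional.Properties using (∈-map⁺; ∈-++⁺ˡ; ∈-++⁺ʳ)
open import Data.List.Properties using (map-tabulate; length-tabulate; map-∘; map-++; map-cong; length-++; length-map)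
open import Data.List.Relation.Unary.Any using (here; there)
open import Data.Nat
open import Data.Nat.DivMod using (m≡m%n+[m/n]*n; m%n<n; m/n*n≤m)
open import Data.Nat.Induction using (<-rec)
open import Data.Nat.ListAction using (sum)
open import Data.Nat.ListAction.Properties using (sum-++)
open import Data.Nat.Logarithm using (⌊log₂_⌋; ⌊log₂⌋-mono-≤; ⌊log₂⌊n/2⌋⌋≡⌊log₂n⌋∸1)
open import Data.Nat.Properties
open import Data.Nat.Tactic.RingSolver using (solve-∀)
open import Data.Product using (∃; _,_)
open import Data.Vec as Vec using (Vec; []; _∷_)
open import Data.Vec.Relation.Unary.All as All using (All; []; _∷_)
open import Data.Vec.Relation.Unary.All.Properties using (map⁺)
open import Function using (_∘_; id)
open import Relation.Binary.PropositionalEquality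
open import Relation.Nullary using (¬_; Dec; yes; no; does; contradiction)

private variable
  A B E G : Set

-- Finite sums

∑ : List A → (A → ℕ) → ℕ
∑ xs f = sum (map f xs)

∑-mono : ∀ (xs : List A) {f g : A → ℕ} → (∀ x → f x ≤ g x) → ∑ xs f ≤ ∑ xs g
∑-mono []       f≤g = z≤n
∑-mono (x ∷ xs) f≤g = +-mono-≤ (f≤g x) (∑-mono xs f≤g)

∑-cong : ∀ (xs : List A) {f g : A → ℕ} → (∀ x → f x ≡ g x) → ∑ xs f ≡ ∑ xs g
∑-cong xs f≡g = cong sum (map-cong f≡g xs)

∑-distrib-+ : ∀ (xs : List A) (f g : A → ℕ) → ∑ xs (λ x → f x + g x) ≡ ∑ xs f + ∑ xs g
∑-distrib-+ []       f g = refl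
∑-distrib-+ (x ∷ xs) f g rewrite ∑-distrib-+ xs f g = lemma (f x) (g x) (∑ xs f) (∑ xs g)
  where
  lemma : ∀ a b c d → (a + b) + (c + d) ≡ (a + c) + (b + d)
  lemma = solve-∀

∑-*ˡ : ∀ c (xs : List A) (f : A → ℕ) → ∑ xs (λ x → c * f x) ≡ c * ∑ xs f
∑-*ˡ c []       f = sym (*-zeroʳ c)
∑-*ˡ c (x ∷ xs) f = trans (cong (c * f x +_) (∑-*ˡ c xs f)) (sym (*-distribˡ-+ c (f x) _))

∑-const : ∀ (xs : List A) c → ∑ xs (λ _ → c) ≡ length xs * c
∑-const []       c = refl
∑-const (x ∷ xs) c = cong (c +_) (∑-const xs c)

∑-swap : ∀ (xs : List A) (ys : List B) (f : A → B → ℕ) →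
         ∑ xs (λ x → ∑ ys (f x)) ≡ ∑ ys (λ y → ∑ xs (λ x → f x y))
∑-swap []       ys f = sym (trans (∑-const ys 0) (*-zeroʳ (length ys)))
∑-swap (x ∷ xs) ys f = trans (cong (∑ ys (f x) +_) (∑-swap xs ys f))
                             (sym (∑-distrib-+ ys (f x) _))

∑-map : ∀ (xs : List A) (h : A → B) (f : B → ℕ) → ∑ (map h xs) f ≡ ∑ xs (f ∘ h)
∑-map xs h f = cong sum (sym (map-∘ xs))

∑-++ : ∀ (xs ys : List A) (f : A → ℕ) → ∑ (xs ++ ys) f ≡ ∑ xs f + ∑ ys f
∑-++ xs ys f = trans (cong sum (map-++ f xs ys)) (sum-++ (map f xs) (map f ys))

∑-∈ : ∀ {x} {xs : List A} (f : A → ℕ) → x ∈ xs → f x ≤ ∑ xs f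
∑-∈ f (here refl) = m≤m+n _ _
∑-∈ {x = x} {y ∷ xs} f (there x∈xs) = ≤-trans (∑-∈ f x∈xs) (m≤n+m _ (f y))

∑-allFin-suc : ∀ n (f : Fin (suc n) → ℕ) → ∑ (allFin (suc n)) f ≡ f zero + ∑ (allFin n) (f ∘ suc)
∑-allFin-suc n f = cong (λ l → f zero + sum l)
  (trans (map-tabulate suc f) (sym (map-tabulate id (f ∘ suc))))

length-allFin : ∀ n → length (allFin n) ≡ n
length-allFin n = length-tabulate {n = n} id

vecs : List A → ∀ n → List (Vec A n)
vecs xs zero    = [] ∷ []
vecs xs (suc n) = cartesianProductWith _∷_ xs (vecs xs n)

∑-vecs-suc : ∀ (xs : List A) n (f : Vec A (suc n) → ℕ) →
             ∑ (vecs xs (suc n)) f ≡ ∑ xs (λ x → ∑ (vecs xs n) (λ v → f (x ∷ v)))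
∑-vecs-suc {A = A} xs n f = go xs
  where
  go : ∀ (ys : List A) → ∑ (cartesianProductWith _∷_ ys (vecs xs n)) f
                         ≡ ∑ ys (λ y → ∑ (vecs xs n) (λ v → f (y ∷ v)))
  go []       = refl
  go (y ∷ ys) = trans (∑-++ (map (y ∷_) (vecs xs n)) _ f)
                      (cong₂ _+_ (∑-map (vecs xs n) (y ∷_) f) (go ys))

length-∑ : ∀ (xs : List A) → length xs ≡ ∑ xs (λ _ → 1)
length-∑ xs = sym (trans (∑-const xs 1) (*-identityʳ _))

length-vecs : ∀ (xs : List A) n → length (vecs xs n) ≡ length xs ^ n
length-vecs xs zero    = refl
length-vecs xs (suc n) = begin
  length (vecs xs (suc n))                    ≡⟨ length-∑ (vecs xs (suc n)) ⟩
  ∑ (vecs xs (suc n)) (λ _ → 1)               ≡⟨ ∑-vecs-suc xs n (λ _ → 1) ⟩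
  ∑ xs (λ _ → ∑ (vecs xs n) (λ _ → 1))        ≡⟨ ∑-cong xs (λ _ → sym (length-∑ (vecs xs n))) ⟩
  ∑ xs (λ _ → length (vecs xs n))             ≡⟨ ∑-const xs _ ⟩
  length xs * length (vecs xs n)              ≡⟨ cong (length xs *_) (length-vecs xs n) ⟩
  length xs ^ suc n                           ∎
  where open ≡-Reasoning

-- Enumeration of coin strings and messages

𝟙 : Bool → ℕ
𝟙 b = if b then 1 else 0

bits : ∀ r → List (Vec Bool r)
bits = vecs (true ∷ false ∷ [])

countᵇ-∑ : ∀ r (P : Vec Bool r → Bool) → countᵇ r P ≡ ∑ (bits r) (𝟙 ∘ P)
countᵇ-∑ zero    P = sym (+-identityʳ _)
countᵇ-∑ (suc r) P = begin
  countᵇ r (P ∘ (true ∷_)) + countᵇ r (P ∘ (false ∷_))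
    ≡⟨ cong₂ _+_ (countᵇ-∑ r _) (trans (countᵇ-∑ r _) (sym (+-identityʳ _))) ⟩
  ∑ (true ∷ false ∷ []) (λ b → ∑ (bits r) (λ ρ → 𝟙 (P (b ∷ ρ))))
    ≡⟨ ∑-vecs-suc (true ∷ false ∷ []) r (𝟙 ∘ P) ⟨
  ∑ (bits (suc r)) (𝟙 ∘ P) ∎
  where open ≡-Reasoning

countᵇ-true : ∀ r → countᵇ r (λ _ → true) ≡ 2 ^ r
countᵇ-true r = begin
  countᵇ r (λ _ → true) ≡⟨ countᵇ-∑ r (λ _ → true) ⟩
  ∑ (bits r) (λ _ → 1)  ≡⟨ length-∑ (bits r) ⟨
  length (bits r)       ≡⟨ length-vecs (true ∷ false ∷ []) r ⟩
  2 ^ r                 ∎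
  where open ≡-Reasoning

messages : (c : ℕ) → List (List Bool)
messages zero    = [] ∷ []
messages (suc c) = [] ∷ map (true ∷_) (messages c) ++ map (false ∷_) (messages c)

∈-messages : ∀ {c : ℕ} M → length M ≤ c → M ∈ messages c
∈-messages {zero}  []          _       = here refl
∈-messages {suc c} []          _       = here refl
∈-messages {suc c} (true ∷ M)  (s≤s p) = there (∈-++⁺ˡ (∈-map⁺ (true ∷_) (∈-messages M p)))
∈-messages {suc c} (false ∷ M) (s≤s p) =
  there (∈-++⁺ʳ (map (true ∷_) (messages c)) (∈-map⁺ (false ∷_) (∈-messages M p)))

length-messages : (c : ℕ) → suc (length (messages c)) ≡ 2 ^ suc c
length-messages zero    = refl
length-messages (suc c) = begin
  2 + length (map (true ∷_) (messages c) ++ map (false ∷_) (messages c))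
    ≡⟨ cong (2 +_) (trans (length-++ (map (true ∷_) (messages c)))
        (cong₂ _+_ (length-map _ (messages c)) (length-map _ (messages c)))) ⟩
  2 + (length (messages c) + length (messages c))
    ≡⟨ lemma (length (messages c)) ⟩
  2 * suc (length (messages c))
    ≡⟨ cong (2 *_) (length-messages c) ⟩
  2 ^ suc (suc c) ∎
  where
  open ≡-Reasoning
  lemma : ∀ a → 2 + (a + a) ≡ 2 * suc a
  lemma = solve-∀

-- Sequential prediction: exponential moments of the number of correct guesses

-- The score of a sequential predictor: the guess `γ j` for entry `j` sees only the earlier entries,
-- encoded by `e`. If `γ` ignores its second argument, this is a plain coordinatewise score.
total : (A → E) → (G → A → ℕ) → ∀ {t} → ((j : Fin t) → Vec E (toℕ j) → G) → Vec A t → ℕ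
total e s {t} γ v = ∑ (allFin t) (λ j → s (γ j (prefix (Vec.map e v) j)) (lookupV v j))

-- The guess for the first entry sees nothing, so it is one fixed `g` and contributes a factor of at
-- most `Z`. Once the first entry `x` is fixed, the predictor with `e x` filled in is again
-- sequential, and the inductive bound for it does not depend on `x`.
∑-vecs-^-total : ∀ (xs : List A) (e : A → E) (s : G → A → ℕ) y Z →
  (∀ g → ∑ xs (λ x → y ^ s g x) ≤ Z) →
  ∀ t (γ : (j : Fin t) → Vec E (toℕ j) → G) →
  ∑ (vecs xs t) (λ v → y ^ total e s γ v) ≤ Z ^ t
∑-vecs-^-total xs e s y Z bound zero    γ = ≤-refl
∑-vecs-^-total xs e s y Z bound (suc t) γ = begin
  ∑ (vecs xs (suc t)) (λ v → y ^ total e s γ v)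
    ≡⟨ ∑-vecs-suc xs t _ ⟩
  ∑ xs (λ x → ∑ (vecs xs t) (λ v → y ^ total e s γ (x ∷ v)))
    ≡⟨ ∑-cong xs (λ x → trans (∑-cong (vecs xs t) (λ v → trans
         (cong (y ^_) (∑-allFin-suc t (λ j → s (γ j (prefix (Vec.map e (x ∷ v)) j)) (lookupV (x ∷ v) j))))
         (^-distribˡ-+-* y (s (γ zero []) x) _)))
         (∑-*ˡ (y ^ s (γ zero []) x) (vecs xs t) _)) ⟩
  ∑ xs (λ x → y ^ s (γ zero []) x * ∑ (vecs xs t) (λ v → y ^ total e s (λ j p → γ (suc j) (e x ∷ p)) v))
    ≤⟨ ∑-mono xs (λ x → ≤-trans (*-monoʳ-≤ (y ^ s (γ zero []) x)
           (∑-vecs-^-total xs e s y Z bound t (λ j p → γ (suc j) (e x ∷ p))))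
         (≤-reflexive (*-comm _ (Z ^ t)))) ⟩
  ∑ xs (λ x → Z ^ t * y ^ s (γ zero []) x)
    ≡⟨ ∑-*ˡ (Z ^ t) xs _ ⟩
  Z ^ t * ∑ xs (λ x → y ^ s (γ zero []) x)
    ≤⟨ *-monoʳ-≤ (Z ^ t) (bound (γ zero [])) ⟩
  Z ^ t * Z
    ≡⟨ *-comm (Z ^ t) Z ⟩
  Z ^ suc t ∎
  where open ≤-Reasoning

hit miss : ∀ {k} → Fin k → Fin k → ℕ
hit  a b = 𝟙 (does (a ≟ᶠ b))
miss a b = 𝟙 (not (does (a ≟ᶠ b)))

hit+miss : ∀ {k} (a b : Fin k) → hit a b + miss a b ≡ 1
hit+miss a b with does (a ≟ᶠ b)
... | true  = refl
... | false = refl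

-- One symbol contributes `y` and the other `k - 1` contribute 1 each; the exact value `y + (k - 1)`
-- is rounded up to keep the formula free of subtraction.
∑-^-hit : ∀ k y (g : Fin k) → ∑ (allFin k) (λ a → y ^ hit g a) ≤ y + k
∑-^-hit (suc k) y zero    = begin
  ∑ (allFin (suc k)) (λ a → y ^ hit zero a) ≡⟨ ∑-allFin-suc k (λ a → y ^ hit zero a) ⟩
  y * 1 + ∑ (allFin k) (λ _ → 1)            ≡⟨ cong₂ _+_ (*-identityʳ y) (trans (sym (length-∑ (allFin k))) (length-allFin k)) ⟩
  y + k                                     ≤⟨ +-monoʳ-≤ y (n≤1+n k) ⟩
  y + suc k                                 ∎
  where open ≤-Reasoning
∑-^-hit (suc k) y (suc g) = begin
  ∑ (allFin (suc k)) (λ a → y ^ hit (suc g) a)   ≡⟨ ∑-allFin-suc k (λ a → y ^ hit (suc g) a) ⟩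
  1 + ∑ (allFin k) (λ a → y ^ hit (suc g) (suc a)) ≡⟨⟩
  1 + ∑ (allFin k) (λ a → y ^ hit g a)           ≤⟨ s≤s (∑-^-hit k y g) ⟩
  suc (y + k)                                    ≡⟨ +-suc y k ⟨
  y + suc k                                      ∎
  where open ≤-Reasoning

hits misses : ∀ {k m} → (Fin m → Fin k) → Vec (Fin k) m → ℕ
hits   g = total id hit  (λ j _ → g j)
misses g = total id miss (λ j _ → g j)

hits+misses : ∀ {k m} (g : Fin m → Fin k) (x : Vec (Fin k) m) → hits g x + misses g x ≡ m
hits+misses {m = m} g x = begin
  hits g x + misses g x     ≡⟨ ∑-distrib-+ (allFin m) _ _ ⟨
  ∑ (allFin m) (λ i → hit (g i) (lookupV x i) + miss (g i) (lookupV x i))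
                            ≡⟨ ∑-cong (allFin m) (λ i → hit+miss (g i) (lookupV x i)) ⟩
  ∑ (allFin m) (λ _ → 1)    ≡⟨ length-∑ (allFin m) ⟨
  length (allFin m)         ≡⟨ length-allFin m ⟩
  m                         ∎
  where open ≡-Reasoning

-- Two nested uses of the prediction bound: the `m` symbols of one set are guessed simultaneously,
-- without feedback, while the `t` sets are guessed one after another from the preceding ones.
∑-^-hits : ∀ k m y t (e : Vec (Fin k) m → E) (γ : (j : Fin t) → Vec E (toℕ j) → Fin m → Fin k) →
  ∑ (vecs (vecs (allFin k) m) t) (λ v → y ^ total e hits γ v) ≤ (y + k) ^ (m * t)
∑-^-hits k m y t e γ = ≤-trans
  (∑-vecs-^-total (vecs (allFin k) m) e hits y ((y + k) ^ m)
    (λ g → ∑-vecs-^-total (allFin k) id hit y (y + k) (∑-^-hit k y) m (λ j _ → g j)) t γ)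
  (≤-reflexive (^-*-assoc (y + k) m t))

total-hits+misses : ∀ {k m t} (e : Vec (Fin k) m → E) (γ : (j : Fin t) → Vec E (toℕ j) → Fin m → Fin k) v →
  total e hits γ v + total e misses γ v ≡ m * t
total-hits+misses {m = m} {t} e γ v = begin
  total e hits γ v + total e misses γ v ≡⟨ ∑-distrib-+ (allFin t) _ _ ⟨
  ∑ (allFin t) (λ j → hits (γ j _) (lookupV v j) + misses (γ j _) (lookupV v j))
                                        ≡⟨ ∑-cong (allFin t) (λ j → hits+misses (γ j _) (lookupV v j)) ⟩
  ∑ (allFin t) (λ _ → m)                ≡⟨ ∑-const (allFin t) m ⟩
  length (allFin t) * m                 ≡⟨ cong (_* m) (length-allFin t) ⟩
  t * m                                 ≡⟨ *-comm t m ⟩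
  m * t                                 ∎
  where open ≡-Reasoning

-- A Jensen-type inequality for exponential moments

1+n≤2^n : ∀ n → suc n ≤ 2 ^ n
1+n≤2^n zero    = ≤-refl
1+n≤2^n (suc n) = begin
  suc (suc n)       ≤⟨ s≤s (m≤n+m (suc n) n) ⟩
  suc n + suc n     ≤⟨ +-mono-≤ (1+n≤2^n n) (≤-trans (1+n≤2^n n) (m≤m+n _ 0)) ⟩
  2 ^ suc n         ∎
  where open ≤-Reasoning

-- The tangent inequality y^(w-b) ≥ 1 + (w-b), multiplied by y^N so that no subtraction occurs.
^-tangent : ∀ y → 2 ≤ y → ∀ {N} u b w → u + b ≡ N → y ^ N * suc w ≤ y ^ w * y ^ u + y ^ N * b
^-tangent (suc y) 2≤y {N} u b w u+b≡N with b ≤? w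
... | no  b≰w = ≤-trans (*-monoʳ-≤ (suc y ^ N) (≰⇒> b≰w)) (m≤n+m _ _)
... | yes b≤w = begin
  Y ^ N * suc w                     ≡⟨ cong (λ z → Y ^ N * suc z) (m∸n+n≡m b≤w) ⟨
  Y ^ N * (suc d + b)               ≡⟨ *-distribˡ-+ (Y ^ N) (suc d) b ⟩
  Y ^ N * suc d + Y ^ N * b         ≤⟨ +-monoˡ-≤ _ (*-monoʳ-≤ (Y ^ N) (≤-trans (1+n≤2^n d) (^-monoˡ-≤ d 2≤y))) ⟩
  Y ^ N * Y ^ d + Y ^ N * b         ≡⟨ cong (_+ Y ^ N * b) (^-distribˡ-+-* Y N d) ⟨
  Y ^ (N + d) + Y ^ N * b           ≡⟨ cong (λ z → Y ^ z + Y ^ N * b) exponent ⟩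
  Y ^ (w + u) + Y ^ N * b           ≡⟨ cong (_+ Y ^ N * b) (^-distribˡ-+-* Y w u) ⟩
  Y ^ w * Y ^ u + Y ^ N * b         ∎
  where
  open ≤-Reasoning
  Y = suc y
  d = w ∸ b
  lemma : ∀ u b d → u + b + d ≡ d + b + u
  lemma = solve-∀
  exponent : N + d ≡ w + u
  exponent = trans (cong (_+ d) (sym u+b≡N)) (trans (lemma u b d) (cong (_+ u) (m∸n+n≡m b≤w)))

-- The tangent inequality at `w` is summed over `xs`. Its linear terms cancel because the average of
-- `b` is at most `w`.
∑-^-jensen : ∀ (xs : List A) y → 2 ≤ y → ∀ {N} (u b : A → ℕ) w → (∀ x → u x + b x ≡ N) →
  ∑ xs b ≤ w * length xs → y ^ N * length xs ≤ y ^ w * ∑ xs (λ x → y ^ u x)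
∑-^-jensen xs y 2≤y {N} u b w u+b≡N ∑b≤ = +-cancelʳ-≤ (Y * (w * L)) _ _ (begin
  Y * L + Y * (w * L)                           ≡⟨ lemma Y L w ⟩
  L * (Y * suc w)                               ≡⟨ ∑-const xs (Y * suc w) ⟨
  ∑ xs (λ _ → Y * suc w)                        ≤⟨ ∑-mono xs (λ x → ^-tangent y 2≤y (u x) (b x) w (u+b≡N x)) ⟩
  ∑ xs (λ x → y ^ w * y ^ u x + Y * b x)        ≡⟨ ∑-distrib-+ xs _ _ ⟩
  ∑ xs (λ x → y ^ w * y ^ u x) + ∑ xs (λ x → Y * b x)
                                                ≡⟨ cong₂ _+_ (∑-*ˡ (y ^ w) xs _) (∑-*ˡ Y xs b) ⟩
  y ^ w * ∑ xs (λ x → y ^ u x) + Y * ∑ xs b     ≤⟨ +-monoʳ-≤ _ (*-monoʳ-≤ Y ∑b≤) ⟩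
  y ^ w * ∑ xs (λ x → y ^ u x) + Y * (w * L)    ∎)
  where
  open ≤-Reasoning
  Y = y ^ N
  L = length xs
  lemma : ∀ Y L w → Y * L + Y * (w * L) ≡ L * (Y * suc w)
  lemma = solve-∀

-- Decoding a symbol from noisy membership answers

dist : ∀ {m} → (Vec Bool m → Bool) → (Vec Bool m → Bool) → ℕ
dist {m} f g = countᵇ m (λ T → f T xor g T)

-- The queried sets true ∷ T all contain symbol zero; the codewords of distinct symbols still differ
-- on exactly half of the queries.
code : ∀ {m} → Fin (suc m) → Vec Bool m → Bool
code a T = not (lookupV (true ∷ T) a)

-- Returns a symbol whose codeword disagrees with `f` on less than a quarter of the queries. If
-- there is none, the value `zero` is arbitrary.
decode : ∀ {m} → (Vec Bool m → Bool) → Fin (suc m)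
decode {m} f with any? (λ a → 4 * dist f (code a) <? 2 ^ m)
... | yes (a , _) = a
... | no  _       = zero

dist-triangle : ∀ {m} (f g h : Vec Bool m → Bool) → dist g h ≤ dist f g + dist f h
dist-triangle {m} f g h = begin
  dist g h                                        ≡⟨ countᵇ-∑ m _ ⟩
  ∑ (bits m) (λ T → 𝟙 (g T xor h T))              ≤⟨ ∑-mono (bits m) (λ T → pointwise (f T) (g T) (h T)) ⟩
  ∑ (bits m) (λ T → 𝟙 (f T xor g T) + 𝟙 (f T xor h T)) ≡⟨ ∑-distrib-+ (bits m) _ _ ⟩
  _                                               ≡⟨ cong₂ _+_ (countᵇ-∑ m _) (countᵇ-∑ m _) ⟨
  dist f g + dist f h                             ∎
  where
  open ≤-Reasoning
  pointwise : ∀ a b c → 𝟙 (b xor c) ≤ 𝟙 (a xor b) + 𝟙 (a xor c)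
  pointwise a     false false = z≤n
  pointwise a     true  true  = z≤n
  pointwise false false true  = ≤-refl
  pointwise true  false true  = ≤-refl
  pointwise false true  false = ≤-refl
  pointwise true  true  false = ≤-refl

countᵇ-false : ∀ m → countᵇ m (λ _ → false) ≡ 0
countᵇ-false m = trans (countᵇ-∑ m (λ _ → false)) (trans (∑-const (bits m) 0) (*-zeroʳ (length (bits m))))

countᵇ-half-∷ : ∀ {m} (P : Vec Bool (suc m) → Bool) →
  (∀ b → 2 * countᵇ m (P ∘ (b ∷_)) ≡ 2 ^ m) → 2 * countᵇ (suc m) P ≡ 2 ^ suc m
countᵇ-half-∷ {m} P half = begin
  2 * (countᵇ m (P ∘ (true ∷_)) + countᵇ m (P ∘ (false ∷_)))     ≡⟨ *-distribˡ-+ 2 (countᵇ m _) _ ⟩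
  2 * countᵇ m (P ∘ (true ∷_)) + 2 * countᵇ m (P ∘ (false ∷_))   ≡⟨ cong₂ _+_ (half true) (half false) ⟩
  2 ^ m + 2 ^ m                                                  ≡⟨ cong (2 ^ m +_) (+-identityʳ _) ⟨
  2 ^ suc m                                                      ∎
  where open ≡-Reasoning

-- A single coordinate of a uniform bit string is an unbiased bit, and remains so after adding the
-- constant `c`.
countᵇ-xor-lookup : ∀ {m} c (i : Fin m) → 2 * countᵇ m (λ T → c xor not (lookupV T i)) ≡ 2 ^ m
countᵇ-xor-lookup {suc m} false zero    = cong (2 *_) (cong₂ _+_ (countᵇ-false m) (countᵇ-true m))
countᵇ-xor-lookup {suc m} true  zero    =
  cong (2 *_) (trans (cong₂ _+_ (countᵇ-true m) (countᵇ-false m)) (+-identityʳ _))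
countᵇ-xor-lookup {suc m} c     (suc i) =
  countᵇ-half-∷ (λ T → c xor not (lookupV T (suc i))) (λ _ → countᵇ-xor-lookup c i)

dist-comm : ∀ {m} (f g : Vec Bool m → Bool) → dist f g ≡ dist g f
dist-comm {m} f g = trans (countᵇ-∑ m _)
  (trans (∑-cong (bits m) (λ T → cong 𝟙 (xor-comm (f T) (g T)))) (sym (countᵇ-∑ m _)))

dist-lookup : ∀ {m} {i j : Fin m} → i ≢ j →
  2 * dist (λ T → not (lookupV T i)) (λ T → not (lookupV T j)) ≡ 2 ^ m
dist-lookup {suc m} {zero}  {zero}  i≢j = contradiction refl i≢j
dist-lookup {suc m} {zero}  {suc j} i≢j =
  countᵇ-half-∷ (λ T → not (lookupV T zero) xor not (lookupV T (suc j))) (λ b → countᵇ-xor-lookup (not b) j)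
dist-lookup {suc m} {suc i} {zero}  i≢j =
  trans (cong (2 *_) (dist-comm (λ T → not (lookupV T (suc i))) (λ T → not (lookupV T zero))))
        (countᵇ-half-∷ (λ T → not (lookupV T zero) xor not (lookupV T (suc i))) (λ b → countᵇ-xor-lookup (not b) i))
dist-lookup {suc m} {suc i} {suc j} i≢j =
  countᵇ-half-∷ (λ T → not (lookupV T (suc i)) xor not (lookupV T (suc j))) (λ _ → dist-lookup (i≢j ∘ cong suc))

-- The codeword of `zero` is constantly `false`, so comparing it with another codeword counts one
-- unbiased bit. Two nonzero symbols compare two distinct, hence independent, coordinates.
dist-code : ∀ {m} {a b : Fin (suc m)} → a ≢ b → 2 * dist (code a) (code b) ≡ 2 ^ m
dist-code {m} {zero}  {zero}  a≢b = contradiction refl a≢b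
dist-code {m} {zero}  {suc b} a≢b = countᵇ-xor-lookup false b
dist-code {m} {suc a} {zero}  a≢b =
  trans (cong (2 *_) (dist-comm (code (suc a)) (code zero))) (countᵇ-xor-lookup false a)
dist-code {m} {suc a} {suc b} a≢b = dist-lookup (a≢b ∘ cong suc)

-- Unique decoding below half the minimum distance: by the triangle inequality the two codewords are
-- less than 1/2 apart in relative distance, whereas distinct ones are exactly 1/2 apart.
decode-unique : ∀ {m} (f : Vec Bool m → Bool) a b →
  4 * dist f (code a) < 2 ^ m → 4 * dist f (code b) < 2 ^ m → a ≡ b
decode-unique {m} f a b pa pb with a ≟ᶠ b
... | yes a≡b = a≡b
... | no  a≢b = contradiction too-close (n≮n _)
  where
  open ≤-Reasoning
  lemma : ∀ x y → 4 * x + 4 * y ≡ 2 * (2 * (x + y))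
  lemma = solve-∀
  too-close : 2 * 2 ^ m < 2 * 2 ^ m
  too-close = begin-strict
    2 * 2 ^ m                                     ≡⟨ cong (2 *_) (dist-code a≢b) ⟨
    2 * (2 * dist (code a) (code b))              ≤⟨ *-monoʳ-≤ 2 (*-monoʳ-≤ 2 (dist-triangle f (code a) (code b))) ⟩
    2 * (2 * (dist f (code a) + dist f (code b))) ≡⟨ lemma (dist f (code a)) (dist f (code b)) ⟨
    4 * dist f (code a) + 4 * dist f (code b)     <⟨ +-mono-< pa pb ⟩
    2 ^ m + 2 ^ m                                 ≡⟨ cong (2 ^ m +_) (+-identityʳ _) ⟨
    2 * 2 ^ m                                     ∎

decode-correct : ∀ {m} (f : Vec Bool m → Bool) a → 4 * dist f (code a) < 2 ^ m → decode f ≡ a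
decode-correct {m} f a pa with any? (λ b → 4 * dist f (code b) <? 2 ^ m)
... | yes (b , pb) = decode-unique f b a pb pa
... | no  ∄b       = contradiction (a , pa) ∄b

-- A Markov-type bound: a wrong decoding requires at least a quarter of the answers to be wrong, so
-- misses can be charged to wrong answers.
miss-decode : ∀ {m} (f : Vec Bool m → Bool) a → 2 ^ m * miss (decode f) a ≤ 4 * dist f (code a)
miss-decode {m} f a with decode f ≟ᶠ a
... | yes _ = ≤-trans (≤-reflexive (*-zeroʳ (2 ^ m))) z≤n
... | no ≢a with 4 * dist f (code a) <? 2 ^ m
...   | yes close = contradiction (decode-correct f a close) ≢a
...   | no  far   = ≤-trans (≤-reflexive (*-identityʳ (2 ^ m))) (≮⇒≥ far)

-- Encoding symbols and queries as sets of size m + 1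

disjointᵇ-++ : ∀ {m n} (A C : Subset m) {B D : Subset n} →
  disjointᵇ (A Vec.++ B) (C Vec.++ D) ≡ disjointᵇ A C ∧ disjointᵇ B D
disjointᵇ-++ []      []      = refl
disjointᵇ-++ (x ∷ A) (y ∷ C) = trans (cong (not (x ∧ y) ∧_) (disjointᵇ-++ A C)) (sym (∧-assoc (not (x ∧ y)) _ _))

∣++∣ : ∀ {m n} (A : Subset m) (B : Subset n) → ∣ A Vec.++ B ∣ ≡ ∣ A ∣ + ∣ B ∣
∣++∣ []          B = refl
∣++∣ (true ∷ A)  B = cong suc (∣++∣ A B)
∣++∣ (false ∷ A) B = ∣++∣ A B

disjointᵇ-⊥ˡ : ∀ {n} (B : Subset n) → disjointᵇ ⊥ B ≡ true
disjointᵇ-⊥ˡ []      = refl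
disjointᵇ-⊥ˡ (x ∷ B) = disjointᵇ-⊥ˡ B

disjointᵇ-⊥ʳ : ∀ {n} (A : Subset n) → disjointᵇ A ⊥ ≡ true
disjointᵇ-⊥ʳ []          = refl
disjointᵇ-⊥ʳ (true ∷ A)  = disjointᵇ-⊥ʳ A
disjointᵇ-⊥ʳ (false ∷ A) = disjointᵇ-⊥ʳ A

disjointᵇ-⁅⁆ : ∀ {n} (a : Fin n) S → disjointᵇ ⁅ a ⁆ S ≡ not (lookupV S a)
disjointᵇ-⁅⁆ zero    (x ∷ S) = trans (cong (not x ∧_) (disjointᵇ-⊥ˡ S)) (∧-identityʳ (not x))
disjointᵇ-⁅⁆ (suc a) (x ∷ S) = disjointᵇ-⁅⁆ a S

block : ∀ {m k} → Fin m → Subset k → Vec (Subset k) m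
block zero    S = S ∷ Vec.replicate _ ⊥
block (suc i) S = ⊥ ∷ block i S

-- Outside block `i` the query is empty, and inside it the encoded set has the single element
-- `lookupV x i`.
disjointᵇ-block : ∀ {m k} (x : Vec (Fin k) m) i S →
  disjointᵇ (Vec.concat (Vec.map ⁅_⁆ x)) (Vec.concat (block i S)) ≡ not (lookupV S (lookupV x i))
disjointᵇ-block (a ∷ x) zero    S = trans (disjointᵇ-++ ⁅ a ⁆ S)
  (trans (cong₂ _∧_ (disjointᵇ-⁅⁆ a S) (concat-⊥ (Vec.map ⁅_⁆ x))) (∧-identityʳ _))
  where
  concat-⊥ : ∀ {m k} (xs : Vec (Subset k) m) →
    disjointᵇ (Vec.concat xs) (Vec.concat (Vec.replicate m ⊥)) ≡ true
  concat-⊥ []       = refl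
  concat-⊥ (x ∷ xs) = trans (disjointᵇ-++ x ⊥) (cong₂ _∧_ (disjointᵇ-⊥ʳ x) (concat-⊥ xs))
disjointᵇ-block (a ∷ x) (suc i) S = trans (disjointᵇ-++ ⁅ a ⁆ ⊥)
  (cong₂ _∧_ (disjointᵇ-⊥ʳ ⁅ a ⁆) (disjointᵇ-block x i S))

∣concat-⁅⁆∣ : ∀ {m k} (x : Vec (Fin k) m) → ∣ Vec.concat (Vec.map ⁅_⁆ x) ∣ ≡ m
∣concat-⁅⁆∣ []      = refl
∣concat-⁅⁆∣ (a ∷ x) = trans (∣++∣ ⁅ a ⁆ _) (cong₂ _+_ (∣⁅x⁆∣≡1 a) (∣concat-⁅⁆∣ x))

∣concat-block∣ : ∀ {m k} (i : Fin m) (S : Subset k) → ∣ Vec.concat (block i S) ∣ ≡ ∣ S ∣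
∣concat-block∣ {suc m} {k} zero S = trans (∣++∣ S _) (trans (cong (∣ S ∣ +_) (∣concat-⊥∣ m)) (+-identityʳ _))
  where
  ∣concat-⊥∣ : ∀ m → ∣ Vec.concat (Vec.replicate m (⊥ {k})) ∣ ≡ 0
  ∣concat-⊥∣ zero    = refl
  ∣concat-⊥∣ (suc m) = trans (∣++∣ (⊥ {k}) _) (cong₂ _+_ (∣⊥∣≡0 k) (∣concat-⊥∣ m))
∣concat-block∣ {suc m} {k} (suc i) S = trans (∣++∣ (⊥ {k}) _) (cong₂ _+_ (∣⊥∣≡0 k) (∣concat-block∣ i S))

initial : ∀ l → ℕ → Subset l
initial zero    p       = []
initial (suc l) zero    = false ∷ initial l zero
initial (suc l) (suc p) = true ∷ initial l p

∣initial∣ : ∀ {l p} → p ≤ l → ∣ initial l p ∣ ≡ p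
∣initial∣ {zero}          z≤n       = refl
∣initial∣ {suc l} {zero}  z≤n       = ∣initial∣ {l} z≤n
∣initial∣ {suc l} {suc p} (s≤s p≤l) = cong suc (∣initial∣ p≤l)

module _ {m l : ℕ} where

  -- The universe consists of `m` blocks of size `m + 1` and a tail of size `l + 1`. The first tail
  -- element is the dummy that raises the size from `m` to `m + 1`.
  setOf : Vec (Fin (suc m)) m → Subset (m * suc m + suc l)
  setOf x = Vec.concat (Vec.map ⁅_⁆ x) Vec.++ (true ∷ ⊥)

  -- The block part has `1 + ∣ T ∣` elements. The padding to size `m + 1` lies in the tail and
  -- avoids the dummy, so it never meets an encoded set.
  querySet : Fin m → Vec Bool m → Subset (m * suc m + suc l)
  querySet i T = Vec.concat (block i (true ∷ T)) Vec.++ (false ∷ initial l (m ∸ ∣ T ∣))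

  disjointᵇ-querySet : ∀ x i T → disjointᵇ (setOf x) (querySet i T) ≡ code (lookupV x i) T
  disjointᵇ-querySet x i T = trans (disjointᵇ-++ (Vec.concat (Vec.map ⁅_⁆ x)) _)
    (trans (cong₂ _∧_ (disjointᵇ-block x i (true ∷ T)) (disjointᵇ-⊥ˡ (initial l (m ∸ ∣ T ∣)))) (∧-identityʳ _))

  ∣setOf∣ : ∀ x → ∣ setOf x ∣ ≡ suc m
  ∣setOf∣ x = trans (∣++∣ (Vec.concat (Vec.map ⁅_⁆ x)) (true ∷ ⊥))
    (trans (cong₂ _+_ (∣concat-⁅⁆∣ x) (cong suc (∣⊥∣≡0 l))) (+-comm m 1))

  ∣querySet∣ : m ≤ l → ∀ i T → ∣ querySet i T ∣ ≡ suc m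
  ∣querySet∣ m≤l i T = trans (∣++∣ (Vec.concat (block i (true ∷ T))) (false ∷ initial l (m ∸ ∣ T ∣)))
    (trans (cong₂ _+_ (∣concat-block∣ i (true ∷ T)) (∣initial∣ (≤-trans (m∸n≤m m ∣ T ∣) m≤l)))
           (cong suc (m+[n∸m]≡n (∣p∣≤n T))))

-- From protocol error to a bound on the number of messages

not-correctᵇ : ∀ {t n r c} (P : Protocol t n r c) As Bs j ρ → not (correctᵇ P As Bs j ρ)
  ≡ bob P ρ (alice P ρ As) j (prefix As j) Bs xor disjointᵇ (lookupV As j) (lookupV Bs j)
not-correctᵇ P As Bs j ρ
  with bob P ρ (alice P ρ As) j (prefix As j) Bs | disjointᵇ (lookupV As j) (lookupV Bs j)
... | true  | true  = refl
... | true  | false = refl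
... | false | true  = refl
... | false | false = refl

lookupV-map : ∀ {n} (f : A → B) (xs : Vec A n) i → lookupV (Vec.map f xs) i ≡ f (lookupV xs i)
lookupV-map f (x ∷ xs) zero    = refl
lookupV-map f (x ∷ xs) (suc i) = lookupV-map f xs i

lookupV-replicate : ∀ {n} (x : A) (i : Fin n) → lookupV (Vec.replicate n x) i ≡ x
lookupV-replicate x zero    = refl
lookupV-replicate x (suc i) = lookupV-replicate x i

All-replicate : ∀ {P : A → Set} {x} n → P x → All P (Vec.replicate n x)
All-replicate zero    px = []
All-replicate (suc n) px = px ∷ All-replicate n px

-- Averaging: a bound valid for each fixed `y` survives summation over `y` once the sums are
-- interchanged.
*-∑-swap-≤ : ∀ c R (xs : List A) (ys : List B) (f : A → B → ℕ) →
  (∀ y → c * ∑ xs (λ x → f x y) ≤ R) → c * ∑ xs (λ x → ∑ ys (f x)) ≤ length ys * R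
*-∑-swap-≤ c R xs ys f bound = begin
  c * ∑ xs (λ x → ∑ ys (f x))            ≡⟨ cong (c *_) (∑-swap xs ys f) ⟩
  c * ∑ ys (λ y → ∑ xs (λ x → f x y))    ≡⟨ ∑-*ˡ c ys _ ⟨
  ∑ ys (λ y → c * ∑ xs (λ x → f x y))    ≤⟨ ∑-mono ys bound ⟩
  ∑ ys (λ _ → R)                         ≡⟨ ∑-const ys R ⟩
  length ys * R                          ∎
  where open ≤-Reasoning

length-bits : ∀ r → length (bits r) ≡ 2 ^ r
length-bits = length-vecs (true ∷ false ∷ [])

module Decoding {m t l r c} (m≤l : m ≤ l) (P : Protocol t (m * suc m + suc l) r c)
                (P-error : HasErrorAtMost1/ (suc m) 48 P) where

  message : Vec Bool r → Vec (Vec (Fin (suc m)) m) t → List Bool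
  message ρ v = alice P ρ (Vec.map setOf v)

  -- Only the `j`-th of Bob's sets affects the correct output, so all `t` of them are taken to be
  -- the same query.
  answer : Vec Bool r → List Bool → (j : Fin t) → Vec (Subset (m * suc m + suc l)) (toℕ j) →
           Fin m → Vec Bool m → Bool
  answer ρ M j p i T = bob P ρ M j p (Vec.replicate t (querySet i T))

  guess : Vec Bool r → List Bool → (j : Fin t) → Vec (Subset (m * suc m + suc l)) (toℕ j) →
          Fin m → Fin (suc m)
  guess ρ M j p i = decode (answer ρ M j p i)

  -- For each query Bob errs on at most a 1/48 fraction of the coins, hence also on average over the
  -- queries. A missed symbol costs at least a quarter of the queries, so a miss has probability at
  -- most 4/48 = 1/12.
  symbol-error : ∀ v j i → 12 * ∑ (bits r) (λ ρ →
    miss (guess ρ (message ρ v) j (prefix (Vec.map setOf v) j) i) (lookupV (lookupV v j) i)) ≤ 2 ^ r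
  -- The factor `2 ^ m`, the number of queries, makes `miss-decode` applicable.
  symbol-error v j i = *-cancelˡ-≤ (2 ^ m) {{m^n≢0 2 m}} (begin
    2 ^ m * (12 * ∑ (bits r) (λ ρ → miss (decode (f ρ)) a))
      ≡⟨ swap₁ (2 ^ m) _ ⟩
    12 * (2 ^ m * ∑ (bits r) (λ ρ → miss (decode (f ρ)) a))
      ≡⟨ cong (12 *_) (∑-*ˡ (2 ^ m) (bits r) _) ⟨
    12 * ∑ (bits r) (λ ρ → 2 ^ m * miss (decode (f ρ)) a)
      ≤⟨ *-monoʳ-≤ 12 (∑-mono (bits r) (λ ρ → miss-decode (f ρ) a)) ⟩
    12 * ∑ (bits r) (λ ρ → 4 * dist (f ρ) (code a))
      ≡⟨ cong (12 *_) (∑-*ˡ 4 (bits r) _) ⟩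
    12 * (4 * ∑ (bits r) (λ ρ → dist (f ρ) (code a)))
      ≡⟨ *-assoc 12 4 (∑ (bits r) (λ ρ → dist (f ρ) (code a))) ⟨
    48 * ∑ (bits r) (λ ρ → dist (f ρ) (code a))
      ≡⟨ cong (48 *_) (∑-cong (bits r) (λ ρ → countᵇ-∑ m _)) ⟩
    48 * ∑ (bits r) (λ ρ → ∑ (bits m) (λ T → 𝟙 (f ρ T xor code a T)))
      ≤⟨ *-∑-swap-≤ 48 (2 ^ r) (bits r) (bits m) _ query-error ⟩
    length (bits m) * 2 ^ r
      ≡⟨ cong (_* 2 ^ r) (length-bits m) ⟩
    2 ^ m * 2 ^ r ∎)
    where
    open ≤-Reasoning
    As = Vec.map setOf v
    a  = lookupV (lookupV v j) i
    f  = λ ρ → answer ρ (message ρ v) j (prefix As j) i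
    swap₁ : ∀ p s → p * (12 * s) ≡ 12 * (p * s)
    swap₁ = solve-∀
    Bs = λ T → Vec.replicate t (querySet {m} {l} i T)
    wrong : ∀ ρ T → not (correctᵇ P As (Bs T) j ρ) ≡ f ρ T xor code a T
    wrong ρ T = trans (not-correctᵇ P As (Bs T) j ρ) (cong (f ρ T xor_)
      (trans (cong₂ disjointᵇ (lookupV-map setOf v j) (lookupV-replicate (querySet i T) j))
             (disjointᵇ-querySet (lookupV v j) i T)))
    query-error : ∀ T → 48 * ∑ (bits r) (λ ρ → 𝟙 (f ρ T xor code a T)) ≤ 2 ^ r
    query-error T = begin
      48 * ∑ (bits r) (λ ρ → 𝟙 (f ρ T xor code a T))
        ≡⟨ cong (48 *_) (∑-cong (bits r) (λ ρ → cong 𝟙 (wrong ρ T))) ⟨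
      48 * ∑ (bits r) (λ ρ → 𝟙 (not (correctᵇ P As (Bs T) j ρ)))
        ≡⟨ cong (48 *_) (countᵇ-∑ r _) ⟨
      48 * countᵇ r (λ ρ → not (correctᵇ P As (Bs T) j ρ))
        ≡⟨ *-comm 48 (countᵇ r (λ ρ → not (correctᵇ P As (Bs T) j ρ))) ⟩
      countᵇ r (λ ρ → not (correctᵇ P As (Bs T) j ρ)) * 48
        ≤⟨ P-error As (Bs T) (map⁺ (All.universal ∣setOf∣ v))
             (All-replicate t (∣querySet∣ m≤l i T)) j ⟩
      countᵇ r (λ _ → true)
        ≡⟨ countᵇ-true r ⟩
      2 ^ r ∎

  total-error : ∀ v → 12 * ∑ (bits r) (λ ρ → total setOf misses (guess ρ (message ρ v)) v) ≤ m * t * 2 ^ r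
  total-error v = begin
    12 * ∑ (bits r) (λ ρ → total setOf misses (guess ρ (message ρ v)) v)
      ≤⟨ *-∑-swap-≤ 12 (m * 2 ^ r) (bits r) (allFin t) _ set-error ⟩
    length (allFin t) * (m * 2 ^ r)
      ≡⟨ cong (_* (m * 2 ^ r)) (length-allFin t) ⟩
    t * (m * 2 ^ r)
      ≡⟨ *-assoc t m _ ⟨
    t * m * 2 ^ r
      ≡⟨ cong (_* 2 ^ r) (*-comm t m) ⟩
    m * t * 2 ^ r ∎
    where
    open ≤-Reasoning
    set-error : ∀ j → 12 * ∑ (bits r) (λ ρ →
      misses (guess ρ (message ρ v) j (prefix (Vec.map setOf v) j)) (lookupV v j)) ≤ m * 2 ^ r
    set-error j = ≤-trans (*-∑-swap-≤ 12 (2 ^ r) (bits r) (allFin m) _ (symbol-error v j))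
                          (≤-reflexive (cong (_* 2 ^ r) (length-allFin m)))

  -- Jensen over the coins with the input fixed: the average number of misses among `m * t` symbols
  -- is at most a twelfth of them, hence at most `w`.
  hits-lower : ∀ y w → 2 ≤ y → m * t ≤ 12 * w → ∀ v →
    y ^ (m * t) * 2 ^ r ≤ y ^ w * ∑ (bits r) (λ ρ → y ^ total setOf hits (guess ρ (message ρ v)) v)
  hits-lower y w 2≤y N≤12w v = subst
    (λ z → y ^ (m * t) * z ≤ y ^ w * ∑ (bits r) (λ ρ → y ^ total setOf hits (guess ρ (message ρ v)) v))
    (length-bits r)
    (∑-^-jensen (bits r) y 2≤y _ _ w (λ ρ → total-hits+misses setOf (guess ρ (message ρ v)) v)
      (*-cancelˡ-≤ 12 (begin
        12 * ∑ (bits r) _          ≤⟨ total-error v ⟩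
        m * t * 2 ^ r              ≤⟨ *-monoˡ-≤ (2 ^ r) N≤12w ⟩
        12 * w * 2 ^ r             ≡⟨ *-assoc 12 w _ ⟩
        12 * (w * 2 ^ r)           ≡⟨ cong (λ z → 12 * (w * z)) (length-bits r) ⟨
        12 * (w * length (bits r)) ∎)))
    where open ≤-Reasoning

  -- Every message is charged with all inputs, not only with those producing it.
  hits-upper : ∀ y ρ → ∑ (vecs (vecs (allFin (suc m)) m) t) (λ v → y ^ total setOf hits (guess ρ (message ρ v)) v)
    ≤ 2 ^ suc c * (y + suc m) ^ (m * t)
  hits-upper y ρ = begin
    ∑ V (λ v → y ^ total setOf hits (guess ρ (message ρ v)) v)
      ≤⟨ ∑-mono V (λ v → ∑-∈ (λ M → y ^ total setOf hits (guess ρ M) v)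
           (∈-messages {c} (message ρ v) (alice-len P ρ (Vec.map setOf v)))) ⟩
    ∑ V (λ v → ∑ (messages c) (λ M → y ^ total setOf hits (guess ρ M) v))
      ≡⟨ ∑-swap V (messages c) _ ⟩
    ∑ (messages c) (λ M → ∑ V (λ v → y ^ total setOf hits (guess ρ M) v))
      ≤⟨ ∑-mono (messages c) (λ M → ∑-^-hits (suc m) m y t setOf (guess ρ M)) ⟩
    ∑ (messages c) (λ _ → (y + suc m) ^ (m * t))
      ≡⟨ ∑-const (messages c) _ ⟩
    length (messages c) * (y + suc m) ^ (m * t)
      ≤⟨ *-monoˡ-≤ _ (≤-trans (n≤1+n _) (≤-reflexive (length-messages c))) ⟩
    2 ^ suc c * (y + suc m) ^ (m * t) ∎
    where
    open ≤-Reasoning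
    V = vecs (vecs (allFin (suc m)) m) t

  -- Double counting over pairs of an input and a coin string: `hits-lower` holds for each of the
  -- `suc m ^ (m * t)` inputs, `hits-upper` for each of the `2 ^ r` coin strings, and the factor
  -- `2 ^ r` cancels.
  message-count : ∀ y w → 2 ≤ y → m * t ≤ 12 * w →
    suc m ^ (m * t) * y ^ (m * t) ≤ y ^ w * (2 ^ suc c * (y + suc m) ^ (m * t))
  message-count y w 2≤y N≤12w = *-cancelʳ-≤ _ _ (2 ^ r) {{m^n≢0 2 r}} (begin
    suc m ^ N * y ^ N * 2 ^ r
      ≡⟨ *-assoc (suc m ^ N) _ _ ⟩
    suc m ^ N * (y ^ N * 2 ^ r)
      ≡⟨ cong (_* (y ^ N * 2 ^ r)) length-V ⟨
    length V * (y ^ N * 2 ^ r)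
      ≡⟨ ∑-const V _ ⟨
    ∑ V (λ _ → y ^ N * 2 ^ r)
      ≤⟨ ∑-mono V (hits-lower y w 2≤y N≤12w) ⟩
    ∑ V (λ v → y ^ w * ∑ (bits r) (λ ρ → score ρ v))
      ≡⟨ ∑-*ˡ (y ^ w) V _ ⟩
    y ^ w * ∑ V (λ v → ∑ (bits r) (λ ρ → score ρ v))
      ≡⟨ cong (y ^ w *_) (∑-swap V (bits r) _) ⟩
    y ^ w * ∑ (bits r) (λ ρ → ∑ V (score ρ))
      ≤⟨ *-monoʳ-≤ (y ^ w) (∑-mono (bits r) (hits-upper y)) ⟩
    y ^ w * ∑ (bits r) (λ _ → 2 ^ suc c * (y + suc m) ^ N)
      ≡⟨ cong (y ^ w *_) (trans (∑-const (bits r) _) (cong (_* (2 ^ suc c * (y + suc m) ^ N)) (length-bits r))) ⟩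
    y ^ w * (2 ^ r * (2 ^ suc c * (y + suc m) ^ N))
      ≡⟨ rotate (y ^ w) (2 ^ r) _ ⟩
    y ^ w * (2 ^ suc c * (y + suc m) ^ N) * 2 ^ r ∎)
    where
    open ≤-Reasoning
    N = m * t
    V = vecs (vecs (allFin (suc m)) m) t
    score = λ ρ v → y ^ total setOf hits (guess ρ (message ρ v)) v
    length-V : length V ≡ suc m ^ N
    length-V = trans (length-vecs (vecs (allFin (suc m)) m) t)
      (trans (cong (_^ t) (trans (length-vecs (allFin (suc m)) m) (cong (_^ m) (length-allFin (suc m)))))
             (^-*-assoc (suc m) m t))
    rotate : ∀ a b x → a * (b * x) ≡ a * x * b
    rotate = solve-∀

-- With an empty message and `j = zero`, the guess for the first symbol depends on the coins only.
-- It misses at least one of two symbols, so the two miss probabilities sum to at least 1, but each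
-- is at most 1/12.
no-silent-protocol : ∀ {m t l r} → suc m ≤ l → (P : Protocol (suc t) (suc m * suc (suc m) + suc l) r 0) →
  ¬ HasErrorAtMost1/ (suc (suc m)) 48 P
no-silent-protocol {m} {t} {l} {r} m≤l P P-error = contradiction too-small (<⇒≱ too-large)
  where
  open Decoding m≤l P P-error
  open ≤-Reasoning
  constant : Fin (suc (suc m)) → Vec (Vec (Fin (suc (suc m))) (suc m)) (suc t)
  constant a = Vec.replicate (suc t) (Vec.replicate (suc m) a)
  guess₀ : Vec Bool r → Fin (suc (suc m))
  guess₀ ρ = guess ρ [] zero [] zero
  length≤0⇒≡[] : ∀ (M : List Bool) → length M ≤ 0 → M ≡ []
  length≤0⇒≡[] [] _ = refl
  error : ∀ a → 12 * ∑ (bits r) (λ ρ → miss (guess₀ ρ) a) ≤ 2 ^ r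
  error a = ≤-trans (≤-reflexive (cong (12 *_) (∑-cong (bits r) (λ ρ →
    cong (λ M → miss (guess ρ M zero [] zero) a)
      (sym (length≤0⇒≡[] (message ρ (constant a)) (alice-len P ρ (Vec.map setOf (constant a)))))))))
    (symbol-error (constant a) zero zero)
  miss-some : ∀ (g : Fin (suc (suc m))) → 1 ≤ miss g zero + miss g (suc zero)
  miss-some zero    = ≤-refl
  miss-some (suc g) = s≤s z≤n
  too-small : 12 * 2 ^ r ≤ 2 * 2 ^ r
  too-small = begin
    12 * 2 ^ r                   ≡⟨ cong (12 *_) (trans (sym (length-bits r)) (length-∑ (bits r))) ⟩
    12 * ∑ (bits r) (λ _ → 1)    ≤⟨ *-monoʳ-≤ 12 (∑-mono (bits r) (miss-some ∘ guess₀)) ⟩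
    12 * ∑ (bits r) (λ ρ → miss (guess₀ ρ) zero + miss (guess₀ ρ) (suc zero))
                                 ≡⟨ cong (12 *_) (∑-distrib-+ (bits r) _ _) ⟩
    12 * (∑ (bits r) (λ ρ → miss (guess₀ ρ) zero) + ∑ (bits r) (λ ρ → miss (guess₀ ρ) (suc zero)))
                                 ≡⟨ *-distribˡ-+ 12 (∑ (bits r) (λ ρ → miss (guess₀ ρ) zero)) _ ⟩
    12 * ∑ (bits r) (λ ρ → miss (guess₀ ρ) zero) + 12 * ∑ (bits r) (λ ρ → miss (guess₀ ρ) (suc zero))
                                 ≤⟨ +-mono-≤ (error zero) (error (suc zero)) ⟩
    2 ^ r + 2 ^ r                ≡⟨ cong (2 ^ r +_) (+-identityʳ _) ⟨
    2 * 2 ^ r                    ∎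
  too-large : 2 * 2 ^ r < 12 * 2 ^ r
  too-large = *-monoˡ-< (2 ^ r) {{m^n≢0 2 r}} (m≤m+n 3 9)

-- Arithmetic of exponents and logarithms

^-distribʳ-* : ∀ a b n → (a * b) ^ n ≡ a ^ n * b ^ n
^-distribʳ-* a b zero    = refl
^-distribʳ-* a b (suc n) = trans (cong (a * b *_) (^-distribʳ-* a b n)) ([m*n]*[o*p]≡[m*o]*[n*p] a b (a ^ n) (b ^ n))

-- For `y = k ^ 3` this says that `y + k` exceeds `y` by a factor of at most the square root of `k`;
-- squaring keeps the exponents integral.
[k³+k]²≤k⁷ : ∀ k → 2 ≤ k → (k ^ 3 + k) ^ 2 ≤ k ^ 7
[k³+k]²≤k⁷ (suc (suc j)) (s≤s (s≤s z≤n)) = begin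
  (k ^ 3 + k) ^ 2            ≤⟨ m≤m+n _ _ ⟩
  (k ^ 3 + k) ^ 2 + excess   ≡⟨ expand j ⟩
  k ^ 7                      ∎
  where
  open ≤-Reasoning
  k = 2 + j
  -- Taylor coefficients at k = 2 of k^7 - (k^3 + k)^2.
  excess = 28 + j * (188 + j * (383 + j * (384 + j * (218 + j * (72 + j * (13 + j))))))
  expand : ∀ j → let k = 2 + j in
    (k * (k * (k * 1)) + k) * ((k * (k * (k * 1)) + k) * 1)
      + (28 + j * (188 + j * (383 + j * (384 + j * (218 + j * (72 + j * (13 + j)))))))
    ≡ k * (k * (k * (k * (k * (k * (k * 1))))))
  expand = solve-∀

-- The counting inequality is raised to the eighth power. The left side becomes `k ^ (32 * N)`; on
-- the right the factor with `w` costs at most `3 * N` in the exponent of `k` and the prediction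
-- bound at most `28 * N`, which leaves `k ^ N`.
k^N≤2^[8[1+c]] : ∀ k N w c → 2 ≤ k → 24 * w ≤ 3 * N →
  k ^ N * (k ^ 3) ^ N ≤ (k ^ 3) ^ w * (2 ^ suc c * (k ^ 3 + k) ^ N) → k ^ N ≤ 2 ^ (8 * suc c)
k^N≤2^[8[1+c]] k@(suc _) N w c 2≤k 24w≤3N count = *-cancelʳ-≤ _ _ (k ^ (31 * N)) {{m^n≢0 k (31 * N)}} (begin
  k ^ N * k ^ (31 * N)                                    ≡⟨ ^-distribˡ-+-* k N (31 * N) ⟨
  k ^ (N + 31 * N)                                        ≡⟨ cong (k ^_) (exp₁ N) ⟩
  k ^ ((N + 3 * N) * 8)                                   ≡⟨ ^-*-assoc k (N + 3 * N) 8 ⟨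
  (k ^ (N + 3 * N)) ^ 8                                   ≡⟨ cong (_^ 8) (trans (^-distribˡ-+-* k N (3 * N)) (cong (k ^ N *_) (sym (^-*-assoc k 3 N)))) ⟩
  (k ^ N * (k ^ 3) ^ N) ^ 8                               ≤⟨ ^-monoˡ-≤ 8 count ⟩
  ((k ^ 3) ^ w * (2 ^ suc c * (k ^ 3 + k) ^ N)) ^ 8       ≡⟨ trans (^-distribʳ-* ((k ^ 3) ^ w) _ 8) (cong (((k ^ 3) ^ w) ^ 8 *_) (^-distribʳ-* (2 ^ suc c) _ 8)) ⟩
  ((k ^ 3) ^ w) ^ 8 * ((2 ^ suc c) ^ 8 * ((k ^ 3 + k) ^ N) ^ 8)
                                                          ≤⟨ *-mono-≤ first (*-monoʳ-≤ ((2 ^ suc c) ^ 8) last) ⟩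
  k ^ (3 * N) * ((2 ^ suc c) ^ 8 * k ^ (28 * N))          ≡⟨ cong (λ z → k ^ (3 * N) * (z * k ^ (28 * N))) (trans (^-*-assoc 2 (suc c) 8) (cong (2 ^_) (*-comm (suc c) 8))) ⟩
  k ^ (3 * N) * (2 ^ (8 * suc c) * k ^ (28 * N))          ≡⟨ swap₂ (k ^ (3 * N)) (2 ^ (8 * suc c)) (k ^ (28 * N)) ⟩
  2 ^ (8 * suc c) * (k ^ (3 * N) * k ^ (28 * N))          ≡⟨ cong (2 ^ (8 * suc c) *_) (^-distribˡ-+-* k (3 * N) (28 * N)) ⟨
  2 ^ (8 * suc c) * k ^ (3 * N + 28 * N)                  ≡⟨ cong (λ z → 2 ^ (8 * suc c) * k ^ z) (*-distribʳ-+ N 3 28) ⟨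
  2 ^ (8 * suc c) * k ^ (31 * N)                          ∎)
  where
  open ≤-Reasoning
  exp₁ : ∀ N → N + 31 * N ≡ (N + 3 * N) * 8
  exp₁ = solve-∀
  exp₂ : ∀ w → 3 * w * 8 ≡ 24 * w
  exp₂ = solve-∀
  exp₃ : ∀ N → N * 8 ≡ 2 * (4 * N)
  exp₃ = solve-∀
  exp₄ : ∀ N → 7 * (4 * N) ≡ 28 * N
  exp₄ = solve-∀
  swap₂ : ∀ a b c → a * (b * c) ≡ b * (a * c)
  swap₂ = solve-∀
  first : ((k ^ 3) ^ w) ^ 8 ≤ k ^ (3 * N)
  first = begin
    ((k ^ 3) ^ w) ^ 8 ≡⟨ trans (cong (_^ 8) (^-*-assoc k 3 w)) (^-*-assoc k (3 * w) 8) ⟩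
    k ^ (3 * w * 8)   ≡⟨ cong (k ^_) (exp₂ w) ⟩
    k ^ (24 * w)      ≤⟨ ^-monoʳ-≤ k 24w≤3N ⟩
    k ^ (3 * N)       ∎
  last : ((k ^ 3 + k) ^ N) ^ 8 ≤ k ^ (28 * N)
  last = begin
    ((k ^ 3 + k) ^ N) ^ 8       ≡⟨ ^-*-assoc (k ^ 3 + k) N 8 ⟩
    (k ^ 3 + k) ^ (N * 8)       ≡⟨ cong ((k ^ 3 + k) ^_) (exp₃ N) ⟩
    (k ^ 3 + k) ^ (2 * (4 * N)) ≡⟨ ^-*-assoc (k ^ 3 + k) 2 (4 * N) ⟨
    ((k ^ 3 + k) ^ 2) ^ (4 * N) ≤⟨ ^-monoˡ-≤ (4 * N) ([k³+k]²≤k⁷ k 2≤k) ⟩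
    (k ^ 7) ^ (4 * N)           ≡⟨ ^-*-assoc k 7 (4 * N) ⟩
    k ^ (7 * (4 * N))           ≡⟨ cong (k ^_) (exp₄ N) ⟩
    k ^ (28 * N)                ∎

2*⌊n/2⌋≤n : ∀ n → 2 * ⌊ n /2⌋ ≤ n
2*⌊n/2⌋≤n n = begin
  2 * ⌊ n /2⌋         ≡⟨ cong (⌊ n /2⌋ +_) (+-identityʳ _) ⟩
  ⌊ n /2⌋ + ⌊ n /2⌋   ≤⟨ +-monoʳ-≤ ⌊ n /2⌋ (⌊n/2⌋≤⌈n/2⌉ n) ⟩
  ⌊ n /2⌋ + ⌈ n /2⌉   ≡⟨ ⌊n/2⌋+⌈n/2⌉≡n n ⟩
  n                   ∎
  where open ≤-Reasoning

2^⌊log₂n⌋≤n : ∀ n → 1 ≤ n → 2 ^ ⌊log₂ n ⌋ ≤ n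
2^⌊log₂n⌋≤n = <-rec (λ n → 1 ≤ n → 2 ^ ⌊log₂ n ⌋ ≤ n) step
  where
  open ≤-Reasoning
  step : ∀ n → (∀ {i} → i < n → 1 ≤ i → 2 ^ ⌊log₂ i ⌋ ≤ i) → 1 ≤ n → 2 ^ ⌊log₂ n ⌋ ≤ n
  step 1               rec _ = ≤-refl
  step n@(suc (suc j)) rec _ = begin
    2 ^ ⌊log₂ n ⌋               ≡⟨ cong (2 ^_) (m+[n∸m]≡n (⌊log₂⌋-mono-≤ {2} {n} (s≤s (s≤s z≤n)))) ⟨
    2 * 2 ^ (⌊log₂ n ⌋ ∸ 1)     ≡⟨ cong (λ z → 2 * 2 ^ z) (⌊log₂⌊n/2⌋⌋≡⌊log₂n⌋∸1 n) ⟨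
    2 * 2 ^ ⌊log₂ ⌊ n /2⌋ ⌋     ≤⟨ *-monoʳ-≤ 2 (rec (⌊n/2⌋<n (suc j)) (s≤s z≤n)) ⟩
    2 * ⌊ n /2⌋                 ≤⟨ 2*⌊n/2⌋≤n n ⟩
    n                           ∎

⌊log₂n⌋<n : ∀ n → 1 ≤ n → ⌊log₂ n ⌋ < n
⌊log₂n⌋<n n 1≤n = ≤-trans (1+n≤2^n ⌊log₂ n ⌋) (2^⌊log₂n⌋≤n n 1≤n)

2^-cancel-≤ : ∀ a b → 2 ^ a ≤ 2 ^ b → a ≤ b
2^-cancel-≤ a b p with a ≤? b
... | yes a≤b = a≤b
... | no  a≰b = contradiction p (<⇒≱ (^-monoʳ-< 2 ≤-refl (≰⇒> a≰b)))

-- The bound for `k ≥ 2` and the final statement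

lower-bound : ∀ m t l r c → suc m ≤ l → (P : Protocol (suc t) (suc m * suc (suc m) + suc l) r c) →
  HasErrorAtMost1/ (suc (suc m)) 48 P → suc t * suc (suc m) * ⌊log₂ suc (suc m) ⌋ ≤ 1152 * c
lower-bound m t l r zero    m≤l P P-error = contradiction P-error (no-silent-protocol m≤l P)
lower-bound m t l r (suc c) m≤l P P-error = ≤-trans tkL≤2NL (by-size (24 ≤? N))
  where
  open ≤-Reasoning
  k = suc (suc m)
  N = suc m * suc t
  L = ⌊log₂ k ⌋
  -- Since `k ≥ 2`, using only `k - 1` symbols per set loses at most a factor of 2.
  tkL≤2NL : suc t * k * L ≤ 2 * N * L
  tkL≤2NL = *-monoˡ-≤ L (begin
    suc t * suc (suc m)                     ≤⟨ m≤m+n _ (suc t * m) ⟩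
    suc t * suc (suc m) + suc t * m         ≡⟨ double m t ⟩
    2 * N                                   ∎)
    where
    double : ∀ m t → suc t * suc (suc m) + suc t * m ≡ 2 * (suc m * suc t)
    double = solve-∀
  -- An integer above the average number of misses. Rounding costs at most 1, which `N ≥ 24` absorbs
  -- in `24 * w ≤ 3 * N`.
  w = suc (N / 12)
  N≤12w : N ≤ 12 * w
  N≤12w = begin
    N                       ≡⟨ m≡m%n+[m/n]*n N 12 ⟩
    N % 12 + N / 12 * 12    ≤⟨ +-monoˡ-≤ _ (<⇒≤ (m%n<n N 12)) ⟩
    12 + N / 12 * 12        ≡⟨ *-comm w 12 ⟩
    12 * w                  ∎
  by-size : Dec (24 ≤ N) → 2 * N * L ≤ 1152 * suc c
  by-size (yes 24≤N) = begin
    2 * N * L               ≡⟨ trans (*-assoc 2 N L) (cong (2 *_) (*-comm N L)) ⟩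
    2 * (L * N)             ≤⟨ *-monoʳ-≤ 2 (2^-cancel-≤ (L * N) (8 * suc (suc c)) 2^LN≤) ⟩
    2 * (8 * suc (suc c))   ≤⟨ m≤m+n _ (1120 + 1136 * c) ⟩
    2 * (8 * suc (suc c)) + (1120 + 1136 * c) ≡⟨ slack c ⟩
    1152 * suc c            ∎
    where
    slack : ∀ c → 2 * (8 * suc (suc c)) + (1120 + 1136 * c) ≡ 1152 * suc c
    slack = solve-∀
    split : ∀ q → 24 * suc q ≡ 24 + 2 * (q * 12)
    split = solve-∀
    24w≤3N : 24 * w ≤ 3 * N
    24w≤3N = begin
      24 * w                 ≡⟨ split (N / 12) ⟩
      24 + 2 * (N / 12 * 12) ≤⟨ +-mono-≤ 24≤N (*-monoʳ-≤ 2 (m/n*n≤m N 12)) ⟩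
      3 * N                  ∎
    2≤k³ : 2 ≤ k ^ 3
    2≤k³ = ≤-trans (s≤s (s≤s z≤n)) (^-monoʳ-≤ k {1} {3} (s≤s z≤n))
    2^LN≤ : 2 ^ (L * N) ≤ 2 ^ (8 * suc (suc c))
    2^LN≤ = begin
      2 ^ (L * N)     ≡⟨ ^-*-assoc 2 L N ⟨
      (2 ^ L) ^ N     ≤⟨ ^-monoˡ-≤ N (2^⌊log₂n⌋≤n k (s≤s z≤n)) ⟩
      k ^ N           ≤⟨ k^N≤2^[8[1+c]] k N w (suc c) (s≤s (s≤s z≤n)) 24w≤3N
                           (Decoding.message-count m≤l P P-error (k ^ 3) w 2≤k³ N≤12w) ⟩
      2 ^ (8 * suc (suc c)) ∎
  -- Here `L ≤ k - 1 ≤ N`, so everything is bounded by `2 * 24 * 24 = 1152`, and a message length of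
  -- at least 1 suffices. This case fixes the constant.
  by-size (no 24≰N) = begin
    2 * N * L               ≤⟨ *-mono-≤ (*-monoʳ-≤ 2 (<⇒≤ (≰⇒> 24≰N))) L≤24 ⟩
    2 * 24 * 24             ≡⟨⟩
    1152 * 1                ≤⟨ *-monoʳ-≤ 1152 (s≤s z≤n) ⟩
    1152 * suc c            ∎
    where
    L≤24 : L ≤ 24
    L≤24 = begin
      L           ≤⟨ s≤s⁻¹ (⌊log₂n⌋<n k (s≤s z≤n)) ⟩
      suc m       ≤⟨ m≤m*n (suc m) (suc t) ⟩
      N           ≤⟨ <⇒≤ (≰⇒> 24≰N) ⟩
      24          ∎

theorem8p4 : ∃ λ D → ∃ λ C →
    ∀ (t k n : ℕ) → 1 ≤ t → 1 ≤ k → k * k ≤ n →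
    ∀ (r c : ℕ) (P : Protocol t n r c) → HasErrorAtMost1/ k (suc D) P →
    t * k * ⌊log₂ k ⌋ ≤ suc C * c
-- Error 1/48 and constant 1152, each given as a predecessor.
theorem8p4 = 47 , 1151 , bound
  where
  bound : ∀ (t k n : ℕ) → 1 ≤ t → 1 ≤ k → k * k ≤ n →
    ∀ (r c : ℕ) (P : Protocol t n r c) → HasErrorAtMost1/ k 48 P → t * k * ⌊log₂ k ⌋ ≤ 1152 * c
  -- For `k = 1` the logarithm vanishes.
  bound t       1             n _ _ _    r c P P-error = ≤-trans (≤-reflexive (*-zeroʳ (t * 1))) z≤n
  bound (suc t) (suc (suc m)) n _ _ k²≤n r c with m≤n⇒∃[o]m+o≡n k²≤n
  ... | e , refl = subst
    (λ n → (P : Protocol (suc t) n r c) → HasErrorAtMost1/ (suc (suc m)) 48 P →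
           suc t * suc (suc m) * ⌊log₂ suc (suc m) ⌋ ≤ 1152 * c)
    -- With `n = k * k + e`, the `k - 1` blocks of size `k` leave a tail of `k + e` elements, so
    -- `l = k - 1 + e`, which is enough room for the padding.
    (layout m e) (lower-bound m t (suc m + e) r c (m≤m+n (suc m) e))
    where
    layout : ∀ m e → suc m * suc (suc m) + suc (suc m + e) ≡ suc (suc m) * suc (suc m) + e
    layout = solve-∀
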